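{- If $G \in \mathcal{F}$, then $G$ is a $2$-$\gamma_{\rm MB}'$-critical graph.
   Context: All graphs are finite and simple; equality of graphs and membership in a family are meant up to isomorphism. A set $D\subseteq V(G)$ is a dominating set of $G$ if every vertex of $V(G)-D$ has a neighbor in $D$. Maker-Breaker domination game (S-game): two players, Dominator and Staller, alternately select a vertex of $G$ that has not been selected before, with Staller moving first. Dominator's goal is that at some point the set of vertices he has selected is a dominating set of $G$; Staller's goal is to prevent this. The game ends when one of the players accomplishes the goal. If Dominator wins the S-game on $G$ under optimal play, then $\gamma_{\rm MB}'(G)$ is the number of moves Dominator makes when both players play optimally (Dominator wants to minimize the number of his moves, Staller wants to maximize it); equivalently, it is the least $k$ such that Dominator has a strategy guaranteeing that he has selected a dominating set after at most $k$ of his moves. If Staller wins, $\gamma_{\rm MB}'(G)=\infty$. A graph $G$ is $2$-$\gamma_{\rm MB}'$-critical if $\gamma_{\rm MB}'(G)=2$ and $\gamma_{\rm MB}'(G-e)>2$ for every $e\in E(G)$, where $G-e$ is obtained from $G$ by deleting the edge $e$ (and $\infty>2$). The join $G\vee H$ is obtained from the disjoint union of $G$ and $H$ by adding all edges $uv$ with $u\in V(G)$, $v\in V(H)$. For $m\ge 2$ let $H_m=K_2\vee \overline{K_{m-2}}$ (so $H_2=K_2$), a graph on $m$ vertices; $H_0$ is the graph with no vertices. Family $\mathcal{F}$: let $t\ge 1$ be an integer and let $m_1\le m_2$ be integers with $m_1\in\{0,2,3,4,\ldots\}$ and $m_2\ge 2$; if $m_1=0$, assume in addition $t\ge 2$.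 Let $\{v_1,v_2\}$ and $B$ be independent sets of vertices, $v_1\neq v_2$, $|B|=t$. The graph $F_{m_1,t,m_2}$ is obtained from the disjoint union of $H_{m_1}$, $H_{m_2}$, $B$ and $\{v_1,v_2\}$ by adding an edge between $v_1$ and each vertex of $H_{m_1}$, an edge between $v_2$ and each vertex of $H_{m_2}$, and all edges between $\{v_1,v_2\}$ and $B$. The family $\mathcal{F}$ consists of all graphs $F_{m_1,t,m_2}$ with such $m_1,t,m_2$. -}

module Defs where

open import Level using (0ℓ)
open import Data.Bool.Base using (Bool; true; false; T; if_then_else_)
open import Data.Bool.Properties using (T?)
open import Data.Fin.Base using (Fin; zero; suc)
import Data.Fin.Properties as Fin
open import Data.List.Base using (List; []; _∷_)
import Data.List.Membership.DecPropositional as DecMembership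
open import Data.Nat.Base as ℕ using (ℕ; zero; suc; _∸_)
import Data.Nat.Properties as ℕ
open import Data.Product.Base using (_×_; _,_; ∃-syntax)
open import Data.Sum.Base using (_⊎_; inj₁; inj₂)
import Data.Sum.Base as Sum
open import Data.Sum.Function.Propositional using (_⊎-↔_)
open import Data.Sum.Relation.Binary.Pointwise as Pw using (Pointwise)
open import Data.Vec.Base as Vec using (Vec; lookup; removeAt)
import Data.Vec.Functional as Vector
open import Function.Base using (_∘_)
open import Function.Bundles using (_↔_; _⇔_; Inverse)
open import Function.Construct.Composition using (_↔-∘_)
open import Function.Construct.Identity using (↔-id)
open import Function.Construct.Symmetry using (↔-sym)
open import Function.Properties.Inverse using (↔⇒↣)
open import Relation.Binary.Bundles using (TotalOrder)
open import Relation.Binary.Core using (Rel)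
open import Relation.Binary.Definitions using (Decidable; DecidableEquality; Symmetric)
open import Relation.Binary.PropositionalEquality.Core using (_≡_; _≢_; refl; sym; subst)
open import Relation.Nullary.Construct.Add.Supremum using (_⁺; [_]; ⊤⁺)
open import Relation.Nullary.Decidable using (Dec; does; map′; ¬?; _×-dec_; _⊎-dec_; _→-dec_)
open import Relation.Nullary.Negation using (¬_)
open import Relation.Unary as U using (Pred; _∈_; _∉_)
import Algebra.Construct.NaturalChoice.Max as Max
import Algebra.Construct.NaturalChoice.Min as Min
import Relation.Binary.Construct.Add.Supremum.NonStrict as NonStrict
import Relation.Binary.Construct.Add.Supremum.Strict as Strict

------------------------------------------------------------------------
-- Finite simple graphs

record Graph : Set₁ where
  field
    V       : Set
    order   : ℕ
    finite  : V ↔ Fin order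
    Adj     : Rel V 0ℓ
    adj?    : Decidable Adj
    adj-sym : Symmetric Adj
    loopless : ∀ v → ¬ Adj v v

  infix 4 _≟_
  _≟_ : DecidableEquality V
  _≟_ = Fin.inj⇒≟ (↔⇒↣ finite)

  vertices : Vec V order
  vertices = Vec.tabulate (Inverse.from finite)

  all? : {P : Pred V 0ℓ} → U.Decidable P → Dec (∀ v → P v)
  all? {P} P? = map′
    (λ h v → subst P (Inverse.strictlyInverseʳ finite v) (h (Inverse.to finite v)))
    (λ h i → h (Inverse.from finite i))
    (Fin.all? (P? ∘ Inverse.from finite))

  any? : {P : Pred V 0ℓ} → U.Decidable P → Dec (∃[ v ] P v)
  any? {P} P? = map′
    (λ (i , p) → Inverse.from finite i , p)
    (λ (v , p) → Inverse.to finite v , subst P (sym (Inverse.strictlyInverseʳ finite v)) p)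
    (Fin.any? (P? ∘ Inverse.from finite))

  Dominating : Pred V 0ℓ → Set
  Dominating D = ∀ v → v ∉ D → ∃[ u ] (u ∈ D × Adj v u)

  dominating? : {D : Pred V 0ℓ} → U.Decidable D → Dec (Dominating D)
  dominating? D? = all? λ v → ¬? (D? v) →-dec any? λ u → D? u ×-dec adj? v u

open Graph using (V; Adj)

record _≅_ (G H : Graph) : Set where
  field
    bijection : V G ↔ V H
    adjacency : ∀ u v → Adj G u v ⇔ Adj H (Inverse.to bijection u) (Inverse.to bijection v)

-- Edges are unordered: both orientations of uv go.  If uv is not an edge, G is
-- unchanged.
infix 7 _-[_,_]
_-[_,_] : (G : Graph) → V G → V G → Graph
G -[ u , v ] = record
  { V        = V G
  ; order    = order
  ; finite   = finite
  ; Adj      = λ x y → Adj G x y × ¬ Removed x y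
  ; adj?     = λ x y → adj? x y ×-dec
                 ¬? ((x ≟ u ×-dec y ≟ v) ⊎-dec (x ≟ v ×-dec y ≟ u))
  ; adj-sym  = λ (a , ¬r) → adj-sym a , λ where
                 (inj₁ (p , q)) → ¬r (inj₂ (q , p))
                 (inj₂ (p , q)) → ¬r (inj₁ (q , p))
  ; loopless = λ x (a , _) → loopless x a
  }
  where
  open Graph G hiding (V; Adj)
  Removed : Rel (V G) 0ℓ
  Removed x y = (x ≡ u × y ≡ v) ⊎ (x ≡ v × y ≡ u)

K : ℕ → Graph
K n = record
  { V        = Fin n
  ; order    = n
  ; finite   = ↔-id (Fin n)
  ; Adj      = _≢_
  ; adj?     = λ x y → ¬? (x Fin.≟ y)
  ; adj-sym  = λ x≢y y≡x → x≢y (sym y≡x)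
  ; loopless = λ _ x≢x → x≢x refl
  }

complement : Graph → Graph
complement G = record
  { V        = V G
  ; order    = order
  ; finite   = finite
  ; Adj      = λ x y → x ≢ y × ¬ Adj G x y
  ; adj?     = λ x y → ¬? (x ≟ y) ×-dec ¬? (adj? x y)
  ; adj-sym  = λ (x≢y , ¬a) → (λ y≡x → x≢y (sym y≡x)) , (λ a → ¬a (adj-sym a))
  ; loopless = λ _ (x≢x , _) → x≢x refl
  }
  where open Graph G hiding (V; Adj)

infixr 5 _⊕_
_⊕_ : Graph → Graph → Graph
G ⊕ H = record
  { V        = V G ⊎ V H
  ; order    = G.order ℕ.+ H.order
  ; finite   = ↔-sym Fin.+↔⊎ ↔-∘ (G.finite ⊎-↔ H.finite)
  ; Adj      = Pointwise (Adj G) (Adj H)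
  ; adj?     = Pw.⊎-decidable G.adj? H.adj?
  ; adj-sym  = Pw.⊎-symmetric G.adj-sym H.adj-sym
  ; loopless = λ where
      (inj₁ x) (Pw.inj₁ a) → G.loopless x a
      (inj₂ y) (Pw.inj₂ a) → H.loopless y a
  }
  where
  module G = Graph G
  module H = Graph H

-- The new edges xy are those with  new x y  or  new y x  true.
addEdges : (G : Graph) (new : V G → V G → Bool) → (∀ v → ¬ T (new v v)) → Graph
addEdges G new irr = record
  { V        = V G
  ; order    = order
  ; finite   = finite
  ; Adj      = λ x y → Adj G x y ⊎ (T (new x y) ⊎ T (new y x))
  ; adj?     = λ x y → adj? x y ⊎-dec (T? (new x y) ⊎-dec T? (new y x))
  ; adj-sym  = Sum.map adj-sym Sum.swap
  ; loopless = λ where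
      x (inj₁ a)        → loopless x a
      x (inj₂ (inj₁ t)) → irr x t
      x (inj₂ (inj₂ t)) → irr x t
  }
  where open Graph G hiding (V; Adj)

infixr 5 _∨ᴳ_
_∨ᴳ_ : Graph → Graph → Graph
G ∨ᴳ H = addEdges (G ⊕ H) cross λ where
    (inj₁ _) ()
    (inj₂ _) ()
  where
  cross : V G ⊎ V H → V G ⊎ V H → Bool
  cross (inj₁ _) (inj₂ _) = true
  cross _        _        = false

------------------------------------------------------------------------
-- The Maker-Breaker domination number for the Staller-first game

ℕ∞ : Set
ℕ∞ = ℕ ⁺

open NonStrict ℕ._≤_ public using (_≤⁺_)
open Strict ℕ._<_ public using (_<⁺_)

ℕ∞-totalOrder : TotalOrder 0ℓ 0ℓ 0ℓ
ℕ∞-totalOrder = record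
  { isTotalOrder = NonStrict.≤⁺-isTotalOrder-≡ ℕ._≤_ ℕ.≤-isTotalOrder }

open Min ℕ∞-totalOrder public using (_⊓_)
open Max ℕ∞-totalOrder public using (_⊔_)

1+_ : ℕ∞ → ℕ∞
1+ [ k ] = [ suc k ]
1+ ⊤⁺    = ⊤⁺

minimum maximum : ∀ {n} → (Fin n → ℕ∞) → ℕ∞
minimum = Vector.foldr _⊓_ ⊤⁺
maximum = Vector.foldr _⊔_ [ 0 ]

-- Minimax values of a position, with D the vertices Dominator has selected and
-- free the vertices nobody has selected: the number of further moves Dominator
-- needs under optimal play, ⊤⁺ meaning that he never gets a dominating set.
-- Play continues until D is dominating or no vertex is left; stopping earlier,
-- once Staller has made domination impossible, gives ⊤⁺ as well.  Dominator is
-- to move only when D is not yet dominating.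
module _ (G : Graph) where
  open Graph G using (vertices; dominating?; _≟_)
  open DecMembership _≟_ using (_∈?_)

  stallerToMove dominatorToMove : ∀ {r} (D : List (V G)) (free : Vec (V G) r) → ℕ∞

  stallerToMove {zero} D free =
    if does (dominating? (_∈? D)) then [ 0 ] else ⊤⁺
  stallerToMove {suc r} D free =
    if does (dominating? (_∈? D)) then [ 0 ]
    else maximum λ i → dominatorToMove D (removeAt free i)

  dominatorToMove {zero} D free = ⊤⁺
  dominatorToMove {suc r} D free =
    1+ minimum λ i → stallerToMove (lookup free i ∷ D) (removeAt free i)

  γ′MB : ℕ∞
  γ′MB = stallerToMove [] vertices

_-γ′MB-critical_ : ℕ → Graph → Set
k -γ′MB-critical G =
  γ′MB G ≡ [ k ] × (∀ u v → Adj G u v → [ k ] <⁺ γ′MB (G -[ u , v ]))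

------------------------------------------------------------------------
-- The family 𝓕

-- The value at 1 (a copy of K₂) is junk: 𝓕 never uses it.
H : ℕ → Graph
H zero      = K 0
H m@(suc _) = K 2 ∨ᴳ complement (K (m ∸ 2))

module _ (m₁ t m₂ : ℕ) where

  F-parts : Graph
  F-parts = H m₁ ⊕ H m₂ ⊕ complement (K t) ⊕ complement (K 2)

  pattern inH₁ h = inj₁ h
  pattern inH₂ h = inj₂ (inj₁ h)
  pattern inB b  = inj₂ (inj₂ (inj₁ b))
  pattern v₁     = inj₂ (inj₂ (inj₂ zero))
  pattern v₂     = inj₂ (inj₂ (inj₂ (suc zero)))

  F-new : V F-parts → V F-parts → Bool
  F-new v₁ (inH₁ _) = true
  F-new v₂ (inH₂ _) = true
  F-new v₁ (inB _)  = true
  F-new v₂ (inB _)  = true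
  F-new _  _        = false

  F : Graph
  F = addEdges F-parts F-new λ where
    (inH₁ _) ()
    (inH₂ _) ()
    (inB _)  ()
    v₁       ()
    v₂       ()

record 𝓕 (G : Graph) : Set where
  field
    m₁ t m₂   : ℕ
    t≥1       : 1 ℕ.≤ t
    m₁≤m₂     : m₁ ℕ.≤ m₂
    m₁-range  : m₁ ≡ 0 ⊎ 2 ℕ.≤ m₁
    m₂≥2      : 2 ℕ.≤ m₂
    m₁≡0⇒t≥2  : m₁ ≡ 0 → 2 ℕ.≤ t
    isomorphic : G ≅ F m₁ t m₂

{-# OPTIONS --safe #-}
module Submission where

-- For Dominator the game is played on the dominating pairs of G. In F these are
-- {v₁ , v₂}, the pairs of v₁ with a vertex universal in H_{m₂}, and the pairs of v₂
-- with a vertex universal in H_{m₁} (with any vertex of B if m₁ = 0). Both v₁ and v₂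
-- thus lie in at least three pairs, so Dominator can take one of them, keep two
-- completions available after Staller's first move, and win with his second move;
-- no single vertex dominates. Deleting an edge leaves one of v₁ and v₂ in at most one
-- pair besides {v₁ , v₂}; Staller takes the other one and then spoils the only pair left.

open import Defs
open import Data.Bool.Base using (T; if_then_else_)
open import Data.Fin.Base using (Fin; zero; suc; punchIn; punchOut)
import Data.Fin.Properties as Fin
open import Data.List.Base as List using (List; []; _∷_)
import Data.List.Membership.DecPropositional as DecMembership
open import Data.List.Membership.Propositional using (lose; find) renaming (_∈_ to _∈ˡ_)
open import Data.List.Relation.Unary.Any as Any using (Any; here; there)
import Data.List.Relation.Unary.Any.Properties as Any
open import Data.Nat.Base as ℕ using (ℕ; zero; suc; z≤n; s≤s)
open import Data.Product.Base using (_×_; _,_; proj₁; proj₂; ∃-syntax)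
open import Data.Sum.Base as Sum using (_⊎_; inj₁; inj₂)
open import Data.Vec.Base as Vec using (Vec; lookup; removeAt; []; _∷_)
import Data.Vec.Properties as Vec
import Data.Sum.Relation.Binary.Pointwise as Pw
open import Data.Unit.Base using (tt)
open import Function.Base using (_∘_)
open import Function.Bundles using (Inverse; Equivalence; mk⇔; mk↔ₛ′)
open import Function.Construct.Identity using (↔-id)
open import Function.Definitions using (Injective)
open import Relation.Binary.Bundles using (TotalOrder)
open import Relation.Binary.PropositionalEquality
  using (_≡_; _≢_; refl; sym; trans; cong; subst; subst₂)
import Relation.Binary.Construct.Add.Supremum.NonStrict as NonStrict
import Relation.Binary.Construct.Add.Supremum.Strict as Strict
open import Relation.Nullary.Construct.Add.Supremum using ([_]; ⊤⁺)
open import Relation.Nullary.Decidable using (Dec; does; yes; no)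
open import Relation.Nullary.Negation using (¬_; contradiction)
open import Relation.Unary using (_∈_)
import Algebra.Construct.NaturalChoice.Max as Max
import Algebra.Construct.NaturalChoice.Min as Min

open Graph using (V; Adj; vertices)
open NonStrict using (_≤⊤⁺; [_])
open Strict using ([_]; [_]<⊤⁺)

private
  module ≤⁺ = TotalOrder ℕ∞-totalOrder
  module ⊓ = Min ℕ∞-totalOrder
  module ⊔ = Max ℕ∞-totalOrder

-- Values of positions

0≤⁺ : ∀ k → [ 0 ] ≤⁺ k
0≤⁺ [ k ] = [ z≤n ]
0≤⁺ ⊤⁺    = [ 0 ] ≤⊤⁺

1+-mono-≤⁺ : ∀ {k l} → k ≤⁺ l → (1+ k) ≤⁺ (1+ l)
1+-mono-≤⁺ [ k≤l ]   = [ s≤s k≤l ]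
1+-mono-≤⁺ (k ≤⊤⁺) = (1+ k) ≤⊤⁺

suc≤⁺⇒<⁺ : ∀ {k l} → [ suc k ] ≤⁺ l → [ k ] <⁺ l
suc≤⁺⇒<⁺ [ k<l ] = [ k<l ]
suc≤⁺⇒<⁺ {k} (_ ≤⊤⁺) = [ k ]<⊤⁺

if-elim : ∀ {P A : Set} {x y : A} (C : A → Set) (P? : Dec P) →
          (P → C x) → (¬ P → C y) → C (if does P? then x else y)
if-elim C (yes p) f g = f p
if-elim C (no ¬p) f g = g ¬p

minimum-≤ : ∀ {n} (f : Fin n → ℕ∞) i → minimum f ≤⁺ f i
minimum-≤ f zero    = ⊓.x⊓y≤x (f zero) (minimum (f ∘ suc))
minimum-≤ f (suc i) = ≤⁺.trans (⊓.x⊓y≤y (f zero) (minimum (f ∘ suc))) (minimum-≤ (f ∘ suc) i)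

minimum-glb : ∀ {n k} (f : Fin n → ℕ∞) → (∀ i → k ≤⁺ f i) → k ≤⁺ minimum f
minimum-glb {zero}  f k≤f = _ ≤⊤⁺
minimum-glb {suc n} f k≤f = ⊓.⊓-glb (k≤f zero) (minimum-glb (f ∘ suc) (k≤f ∘ suc))

≤-maximum : ∀ {n} (f : Fin n → ℕ∞) i → f i ≤⁺ maximum f
≤-maximum f zero    = ⊔.x≤x⊔y (f zero) _
≤-maximum f (suc i) = ≤⁺.trans (≤-maximum (f ∘ suc) i) (⊔.x≤y⊔x (f zero) _)

maximum-lub : ∀ {n k} (f : Fin n → ℕ∞) → (∀ i → f i ≤⁺ k) → maximum f ≤⁺ k
maximum-lub {zero}  f f≤k = 0≤⁺ _
maximum-lub {suc n} f f≤k = ⊔.⊔-lub (f≤k zero) (maximum-lub (f ∘ suc) (f≤k ∘ suc))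

-- Selecting a vertex from the free ones

module _ {A : Set} where

  Free : ∀ {r} → A → Vec A r → Set
  Free y xs = ∃[ i ] lookup xs i ≡ y

  Unique : ∀ {r} → Vec A r → Set
  Unique xs = Injective _≡_ _≡_ (lookup xs)

  -- Strategies speak of the selected vertex, whereas the minimax values run over positions in a
  -- vector. This relation hides the position and lets the two lengths vary as separate indices.
  data Move : ∀ {r r′} → Vec A r → A → Vec A r′ → Set where
    select : ∀ {r} (xs : Vec A (suc r)) i → Move xs (lookup xs i) (removeAt xs i)

  lookup-removeAt : ∀ {r} (xs : Vec A (suc r)) i j →
                    lookup (removeAt xs i) j ≡ lookup xs (punchIn i j)
  lookup-removeAt xs i j = trans
    (cong (lookup (removeAt xs i)) (sym (Fin.punchOut-punchIn i)))
    (Vec.removeAt-punchOut xs (Fin.punchInᵢ≢i i j ∘ sym))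

  module _ {r r′ : ℕ} {xs : Vec A r} {x : A} {ys : Vec A r′} where

    move-preserves-free : ∀ {y} → Move xs x ys → Free y xs → y ≢ x → Free y ys
    move-preserves-free (select _ i) (j , refl) y≢x =
      punchOut i≢j , Vec.removeAt-punchOut xs i≢j
      where
      i≢j : i ≢ j
      i≢j i≡j = y≢x (cong (lookup xs) (sym i≡j))

    move-reflects-free : ∀ {y} → Move xs x ys → Free y ys → Free y xs
    move-reflects-free (select _ i) (j , refl) = punchIn i j , sym (lookup-removeAt xs i j)

    move-free : Move xs x ys → Free x xs
    move-free (select _ i) = i , refl

    move-unique : Move xs x ys → Unique xs → Unique ys
    move-unique (select _ i) inj {j} {k} eq = Fin.punchIn-injective i j k (inj
      (trans (sym (lookup-removeAt xs i j)) (trans eq (lookup-removeAt xs i k))))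

    move-fresh : Move xs x ys → Unique xs → ¬ Free x ys
    move-fresh (select _ i) inj (j , eq) =
      Fin.punchInᵢ≢i i j (inj (trans (sym (lookup-removeAt xs i j)) eq))

  free⇒move : ∀ {r x} (xs : Vec A r) → Free x xs → ∃[ r′ ] ∃[ ys ] Move {r} {r′} xs x ys
  free⇒move xs@(_ ∷ _) (i , refl) = _ , _ , select xs i

-- Domination and bounds on the value of a position

Covers : (G : Graph) → V G → V G → Set
Covers G w u = w ≡ u ⊎ Adj G w u

-- Closed neighbourhoods absorb the proviso `v ∉ D` of `Dominating`, so a proof can split on which
-- member of `D` covers `w`.
Dominates : (G : Graph) → List (V G) → Set
Dominates G D = ∀ w → Any (Covers G w) D

module _ (G : Graph) where
  open Graph G using (Dominating; dominating?; _≟_)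
  open DecMembership _≟_ using (_∈?_)

  dominating⇒dominates : ∀ {D} → Dominating (_∈ˡ D) → Dominates G D
  dominating⇒dominates {D} dom w with w ∈? D
  ... | yes w∈D = Any.map inj₁ w∈D
  ... | no  w∉D = let u , u∈D , a = dom w w∉D in lose u∈D (inj₂ a)

  dominates⇒dominating : ∀ {D} → Dominates G D → Dominating (_∈ˡ D)
  dominates⇒dominating dom w w∉D with find (dom w)
  ... | u , u∈D , inj₁ refl = contradiction u∈D w∉D
  ... | u , u∈D , inj₂ a    = u , u∈D , a

  module _ {D : List (V G)} where

    staller-≤0 : ∀ {r} (xs : Vec (V G) r) → Dominates G D → stallerToMove G D xs ≤⁺ [ 0 ]
    staller-≤0 [] dom = if-elim (_≤⁺ [ 0 ]) (dominating? (_∈? D))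
      (λ _ → [ z≤n ]) (contradiction (dominates⇒dominating dom))
    staller-≤0 (_ ∷ _) dom = if-elim (_≤⁺ [ 0 ]) (dominating? (_∈? D))
      (λ _ → [ z≤n ]) (contradiction (dominates⇒dominating dom))

    -- The free vertex excludes the empty vector, where `bound` is vacuous but the value is `⊤⁺`
    -- unless `D` dominates.
    staller-≤ : ∀ {r k x} (xs : Vec (V G) r) → Free x xs →
                (∀ {r′ s} {ys : Vec (V G) r′} → Move xs s ys → dominatorToMove G D ys ≤⁺ k) →
                stallerToMove G D xs ≤⁺ k
    staller-≤ {k = k} xs@(_ ∷ _) _ bound = if-elim (_≤⁺ k) (dominating? (_∈? D))
      (λ _ → 0≤⁺ _) (λ _ → maximum-lub _ (λ i → bound (select xs i)))

    dominator-≤ : ∀ {r r′ k d} {xs : Vec (V G) r} {ys : Vec (V G) r′} → Move xs d ys →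
                  stallerToMove G (d ∷ D) ys ≤⁺ k → dominatorToMove G D xs ≤⁺ (1+ k)
    dominator-≤ (select xs i) bound =
      1+-mono-≤⁺ (≤⁺.trans
        (minimum-≤ (λ j → stallerToMove G (lookup xs j ∷ D) (removeAt xs j)) i) bound)

    staller-≥ : ∀ {r r′ k s} {xs : Vec (V G) r} {ys : Vec (V G) r′} → ¬ Dominates G D →
                Move xs s ys → k ≤⁺ dominatorToMove G D ys → k ≤⁺ stallerToMove G D xs
    staller-≥ {k = k} ¬dom (select xs i) bound = if-elim (k ≤⁺_) (dominating? (_∈? D))
      (λ d → contradiction (dominating⇒dominates d) ¬dom)
      (λ _ → ≤⁺.trans bound (≤-maximum (λ j → dominatorToMove G D (removeAt xs j)) i))

    dominator-≥ : ∀ {r k} (xs : Vec (V G) r) →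
                  (∀ {r′ d} {ys : Vec (V G) r′} → Move xs d ys → k ≤⁺ stallerToMove G (d ∷ D) ys) →
                  (1+ k) ≤⁺ dominatorToMove G D xs
    dominator-≥ []         bound = _ ≤⊤⁺
    dominator-≥ xs@(_ ∷ _) bound = 1+-mono-≤⁺ (minimum-glb _ (λ i → bound (select xs i)))

  -- Whatever Staller selects, Dominator has to make another move, which the `1+` in
  -- `dominatorToMove` counts; with no vertex left the value is `⊤⁺`.
  staller-≥1 : ∀ {r D} (xs : Vec (V G) r) → ¬ Dominates G D → [ 1 ] ≤⁺ stallerToMove G D xs
  staller-≥1 {D = D} [] ¬dom = if-elim ([ 1 ] ≤⁺_) (dominating? (_∈? D))
    (λ d → contradiction (dominating⇒dominates d) ¬dom)
    (λ _ → _ ≤⊤⁺)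
  staller-≥1 xs@(_ ∷ _) ¬dom =
    staller-≥ ¬dom (select xs zero) (dominator-≥ (removeAt xs zero) (λ _ → 0≤⁺ _))

  vertices-free : ∀ v → Free v (vertices G)
  vertices-free v = to v , trans (Vec.lookup∘tabulate from (to v)) (strictlyInverseʳ v)
    where open Inverse (Graph.finite G)

  vertices-unique : Unique (vertices G)
  vertices-unique {i} {j} eq =
    trans (sym (strictlyInverseˡ i)) (trans (cong to from≡) (strictlyInverseˡ j))
    where
    open Inverse (Graph.finite G)
    from≡ : from i ≡ from j
    from≡ = trans (sym (Vec.lookup∘tabulate from i)) (trans eq (Vec.lookup∘tabulate from j))

  ¬Dominates-[] : V G → ¬ Dominates G []
  ¬Dominates-[] v dom with dom v
  ... | ()

  -- Strategies read off from dominating pairs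

  NoSingleton : Set
  NoSingleton = ∀ x → ¬ Dominates G (x ∷ [])

  -- Dominator answers s by d; Staller cannot take both completions c and c′.
  record Reply (s : V G) : Set where
    field
      d c c′ : V G
      d≢s : d ≢ s
      c≢s : c ≢ s
      c≢d : c ≢ d
      c′≢s : c′ ≢ s
      c′≢d : c′ ≢ d
      c≢c′ : c ≢ c′
      completes  : Dominates G (c ∷ d ∷ [])
      completes′ : Dominates G (c′ ∷ d ∷ [])

  -- After Staller takes s, only {p , q} can still be a dominating pair, so she
  -- needs just one of p and q as her second move.
  record StallerPlan : Set where
    field
      s p q : V G
      p≢s : p ≢ s
      q≢s : q ≢ s
      p≢q : p ≢ q
      sole-pair : ∀ {x y} → x ≢ s → y ≢ s → Dominates G (x ∷ y ∷ []) →
                  (x ≡ p × y ≡ q) ⊎ (x ≡ q × y ≡ p)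

  -- Dominator's first move is the prescribed `d`. Since `c` and `c′` differ, at least one of them
  -- survives Staller's second move, and it completes a dominating pair.
  γ′MB-≤2 : V G → (∀ s → Reply s) → γ′MB G ≤⁺ [ 2 ]
  γ′MB-≤2 v reply = staller-≤ (vertices G) (vertices-free v) λ {_} {s} {ys} m →
    let open Reply (reply s)
        free : ∀ {x} → x ≢ s → Free x ys
        free = move-preserves-free m (vertices-free _)
        _ , zs , m′ = free⇒move ys (free d≢s)
        c-free  = move-preserves-free m′ (free c≢s) c≢d
        c′-free = move-preserves-free m′ (free c′≢s) c′≢d
    in dominator-≤ m′ (staller-≤ zs c-free λ {_} {s′} {us} m″ →
         finish m″ (s′ ≟ c) c-free c′-free c≢c′ completes completes′)
    where
    finish : ∀ {r r′ s′ d c c′} {zs : Vec (V G) r} {us : Vec (V G) r′} → Move zs s′ us →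
             Dec (s′ ≡ c) → Free c zs → Free c′ zs → c ≢ c′ →
             Dominates G (c ∷ d ∷ []) → Dominates G (c′ ∷ d ∷ []) →
             dominatorToMove G (d ∷ []) us ≤⁺ [ 1 ]
    finish {us = us} m (yes refl) _ fc′ c≢c′ _ dom′ =
      let _ , ws , m′ = free⇒move us (move-preserves-free m fc′ (c≢c′ ∘ sym))
      in dominator-≤ m′ (staller-≤0 ws dom′)
    finish {us = us} m (no s′≢c) fc _ _ dom _ =
      let _ , ws , m′ = free⇒move us (move-preserves-free m fc (s′≢c ∘ sym))
      in dominator-≤ m′ (staller-≤0 ws dom)

  -- Staller's opening move does not matter: any single vertex `d` of Dominator fails to dominate,
  -- so he needs a second.
  γ′MB-≥2 : V G → NoSingleton → [ 2 ] ≤⁺ γ′MB G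
  γ′MB-≥2 v noSingle =
    let _ , ys , m = free⇒move (vertices G) (vertices-free v)
    in staller-≥ (¬Dominates-[] v) m (dominator-≥ ys
         λ {_} {d} {zs} _ → staller-≥1 zs (noSingle d))

  γ′MB-≥3 : NoSingleton → StallerPlan → [ 3 ] ≤⁺ γ′MB G
  γ′MB-≥3 noSingle plan =
    let _ , ys , m = free⇒move (vertices G) (vertices-free s)
    in staller-≥ (¬Dominates-[] s) m (dominator-≥ ys (after m))
    where
    open StallerPlan plan

    module _ {r r′ : ℕ} {d : V G} {ys : Vec (V G) r} {zs : Vec (V G) r′}
             (m : Move (vertices G) s ys) (m′ : Move ys d zs) where

      selected-≢s : ∀ {x} → Free x ys → x ≢ s
      selected-≢s fx refl = move-fresh m vertices-unique fx

      -- If `s′` spoils every pair through `d`, Dominator's second vertex `d′` completes nothing and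
      -- a further move is due. That `d′` was still free is what makes it differ from `s` and `s′`.
      respond : ∀ s′ → Free s′ zs → (∀ {d′} → d′ ≢ s → d′ ≢ s′ → ¬ Dominates G (d′ ∷ d ∷ [])) →
                [ 2 ] ≤⁺ stallerToMove G (d ∷ []) zs
      respond s′ fs′ ¬dom =
        let _ , us , m″ = free⇒move zs fs′
        in staller-≥ (noSingle d) m″ (dominator-≥ us λ {_} {_} {ws} m‴ → staller-≥1 ws
             (¬dom (selected-≢s (move-reflects-free m′ (move-reflects-free m″ (move-free m‴))))
               λ where refl → move-fresh m″ (move-unique m′ (move-unique m vertices-unique))
                                (move-free m‴)))

    after : ∀ {r r′ d} {ys : Vec (V G) r} {zs : Vec (V G) r′} →
            Move (vertices G) s ys → Move ys d zs → [ 2 ] ≤⁺ stallerToMove G (d ∷ []) zs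
    after {d = d} {ys} {zs} m m′ with d ≟ p
    -- Dominator holds `p`, so `q` is his only possible completion and Staller takes it.
    ... | yes refl = respond m m′ q (free q≢s (p≢q ∘ sym)) λ d′≢s d′≢q dom →
          Sum.[ p≢q ∘ proj₂ , d′≢q ∘ proj₁ ] (sole-pair d′≢s p≢s dom)
      where
      free : ∀ {x} → x ≢ s → x ≢ d → Free x zs
      free x≢s = move-preserves-free m′ (move-preserves-free m (vertices-free _) x≢s)
    -- Taking `p` spoils the sole pair if `d` is `q`; for any other `d` no pair through `d`
    -- dominates anyway.
    ... | no d≢p = respond m m′ p (free p≢s (d≢p ∘ sym)) λ d′≢s d′≢p dom →
          Sum.[ d′≢p ∘ proj₁ , d≢p ∘ proj₂ ]
            (sole-pair d′≢s (selected-≢s m m′ (move-free m′)) dom)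
      where
      free : ∀ {x} → x ≢ s → x ≢ d → Free x zs
      free x≢s = move-preserves-free m′ (move-preserves-free m (vertices-free _) x≢s)

-- These certificates mention domination only, so they transport along isomorphisms. The value
-- `γ′MB` is computed along an enumeration of the vertices, which an isomorphism need not respect.
record Critical (G : Graph) : Set where
  field
    vertex      : V G
    reply       : ∀ s → Reply G s
    noSingleton : NoSingleton G
    plan        : ∀ u v → Adj G u v → StallerPlan (G -[ u , v ])

-- Every edge of the deleted graph is an edge of `G`, so whatever fails to dominate `G` also fails
-- after the deletion.
deletion-dominates : ∀ (G : Graph) {u v D} → Dominates (G -[ u , v ]) D → Dominates G D
deletion-dominates G dom w = Any.map (Sum.map₂ proj₁) (dom w)

critical⇒2-critical : ∀ {G} → Critical G → 2 -γ′MB-critical G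
critical⇒2-critical {G} crit =
  ≤⁺.antisym (γ′MB-≤2 G vertex reply) (γ′MB-≥2 G vertex noSingleton) ,
  λ u v uv → suc≤⁺⇒<⁺ (γ′MB-≥3 (G -[ u , v ])
    (λ x → noSingleton x ∘ deletion-dominates G) (plan u v uv))
  where open Critical crit

-- Invariance under isomorphism

module _ {G G′ : Graph} (iso : G ≅ G′) where
  open _≅_ iso
  open Inverse bijection

  private
    to-from : ∀ x → to (from x) ≡ x
    to-from = strictlyInverseˡ

    from≢ : ∀ {x y} → x ≢ y → from x ≢ from y
    from≢ {x} {y} x≢y eq = x≢y (trans (sym (to-from x)) (trans (cong to eq) (to-from y)))

    from≢ˡ : ∀ {x y} → x ≢ to y → from x ≢ y
    from≢ˡ {x} x≢y eq = x≢y (trans (sym (to-from x)) (cong to eq))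

    to≢ : ∀ {x y} → x ≢ from y → to x ≢ y
    to≢ {x} x≢y eq = x≢y (trans (sym (strictlyInverseʳ x)) (cong from eq))

    from-≡ : ∀ {x y} → to x ≡ y → x ≡ from y
    from-≡ {x} eq = trans (sym (strictlyInverseʳ x)) (cong from eq)

  dominates-to : ∀ {D} → Dominates G D → Dominates G′ (List.map to D)
  dominates-to dom w = Any.map⁺ (Any.map
    (λ {u} → Sum.map (λ eq → trans (sym (to-from w)) (cong to eq))
      (λ a → subst (λ z → Adj G′ z (to u)) (to-from w) (Equivalence.to (adjacency (from w) u) a)))
    (dom (from w)))

  dominates-from : ∀ {D} → Dominates G′ (List.map to D) → Dominates G D
  dominates-from dom w = Any.map
    (λ {u} → Sum.map (λ eq → trans (from-≡ eq) (strictlyInverseʳ u))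
                     (Equivalence.from (adjacency w u)))
    (Any.map⁻ (dom (to w)))

  noSingleton-≅ : NoSingleton G′ → NoSingleton G
  noSingleton-≅ noSingle x = noSingle (to x) ∘ dominates-to

  reply-≅ : ∀ {s} → Reply G′ (to s) → Reply G s
  reply-≅ r = record
    { d = from d ; c = from c ; c′ = from c′
    ; d≢s = from≢ˡ d≢s ; c≢s = from≢ˡ c≢s ; c≢d = from≢ c≢d
    ; c′≢s = from≢ˡ c′≢s ; c′≢d = from≢ c′≢d ; c≢c′ = from≢ c≢c′
    ; completes = pull completes ; completes′ = pull completes′
    }
    where
    open Reply r
    pull : ∀ {x y} → Dominates G′ (x ∷ y ∷ []) → Dominates G (from x ∷ from y ∷ [])
    pull {x} {y} dom = dominates-from
      (subst₂ (λ a b → Dominates G′ (a ∷ b ∷ [])) (sym (to-from x)) (sym (to-from y)) dom)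

  plan-≅ : StallerPlan G′ → StallerPlan G
  plan-≅ pl = record
    { s = from s ; p = from p ; q = from q
    ; p≢s = from≢ p≢s ; q≢s = from≢ q≢s ; p≢q = from≢ p≢q
    ; sole-pair = λ x≢s y≢s dom →
        Sum.map (λ (e , e′) → from-≡ e , from-≡ e′) (λ (e , e′) → from-≡ e , from-≡ e′)
          (sole-pair (to≢ x≢s) (to≢ y≢s) (dominates-to dom))
    }
    where open StallerPlan pl

  -- The removed edge is given by equalities of endpoints, which have to be reflected as well as
  -- preserved, hence the injectivity of `to`.
  deletion-≅ : ∀ u v → (G -[ u , v ]) ≅ (G′ -[ to u , to v ])
  deletion-≅ u v = record
    { bijection = bijection
    ; adjacency = λ x y → mk⇔
        (λ (a , ¬r) → Equivalence.to (adjacency x y) a ,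
          ¬r ∘ Sum.map (λ (e , e′) → injective e , injective e′)
                       (λ (e , e′) → injective e , injective e′))
        (λ (a , ¬r) → Equivalence.from (adjacency x y) a ,
          ¬r ∘ Sum.map (λ (e , e′) → cong to e , cong to e′)
                       (λ (e , e′) → cong to e , cong to e′))
    }
    where
    injective : ∀ {x y} → to x ≡ to y → x ≡ y
    injective {y = y} eq = trans (from-≡ eq) (strictlyInverseʳ y)

critical-≅ : ∀ {G G′} → G ≅ G′ → Critical G′ → Critical G
critical-≅ iso crit = record
  { vertex = from vertex
  ; reply = reply-≅ iso ∘ reply ∘ to
  ; noSingleton = noSingleton-≅ iso noSingleton
  ; plan = λ u v uv → plan-≅ (deletion-≅ iso u v)
      (plan (to u) (to v) (Equivalence.to (_≅_.adjacency iso u v) uv))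
  }
  where
  open Critical crit
  open Inverse (_≅_.bijection iso)

-- Deleting an edge

module _ (G : Graph) {u v : V G} where

  deletion-uncovers : Adj G u v → ¬ Covers (G -[ u , v ]) u v
  deletion-uncovers uv (inj₁ refl)    = Graph.loopless G _ uv
  deletion-uncovers _  (inj₂ (_ , r)) = r (inj₁ (refl , refl))

  deletion-uncoversʳ : Adj G u v → ¬ Covers (G -[ u , v ]) v u
  deletion-uncoversʳ uv (inj₁ refl)    = Graph.loopless G _ uv
  deletion-uncoversʳ _  (inj₂ (_ , r)) = r (inj₂ (refl , refl))

-- Both orientations are removed either way, so the identity is an isomorphism; each kind of edge
-- then needs a plan in one orientation only.
plan-flip : ∀ G u v → StallerPlan (G -[ u , v ]) → StallerPlan (G -[ v , u ])
plan-flip G _ _ = plan-≅ record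
  { bijection = ↔-id (V G)
  ; adjacency = λ _ _ → mk⇔ (λ (a , ¬r) → a , ¬r ∘ Sum.swap) (λ (a , ¬r) → a , ¬r ∘ Sum.swap)
  }

-- Some member of a dominating pair covers `w`; by symmetry let it be `y`. A good `w` has few
-- possible covers once `s` is excluded.
plan-covering : ∀ {G} s p q w → p ≢ s → q ≢ s → p ≢ q →
  (∀ {x y} → x ≢ s → y ≢ s → Dominates G (x ∷ y ∷ []) → Covers G w y → x ≡ p × y ≡ q) →
  StallerPlan G
plan-covering {G} s p q w p≢s q≢s p≢q core = record
  { p≢s = p≢s ; q≢s = q≢s ; p≢q = p≢q ; sole-pair = sole-pair }
  where
  flip : ∀ {x y} → Dominates G (x ∷ y ∷ []) → Dominates G (y ∷ x ∷ [])
  flip dom z with dom z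
  ... | here c         = there (here c)
  ... | there (here c) = here c

  sole-pair : ∀ {x y} → x ≢ s → y ≢ s → Dominates G (x ∷ y ∷ []) →
              (x ≡ p × y ≡ q) ⊎ (x ≡ q × y ≡ p)
  sole-pair x≢s y≢s dom with dom w
  ... | there (here c) = inj₁ (core x≢s y≢s dom c)
  ... | here c         = let y≡p , x≡q = core y≢s x≢s (flip dom) c in inj₂ (x≡q , y≡p)

-- The graphs H_m and F

Fin2-third : ∀ {i j : Fin 2} l → i ≢ j → l ≢ i → l ≡ j
Fin2-third {zero}     {zero}     _          i≢j _   = contradiction refl i≢j
Fin2-third {zero}     {suc zero} zero       _   l≢i = contradiction refl l≢i
Fin2-third {zero}     {suc zero} (suc zero) _   _   = refl
Fin2-third {suc zero} {zero}     zero       _   _   = refl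
Fin2-third {suc zero} {zero}     (suc zero) _   l≢i = contradiction refl l≢i
Fin2-third {suc zero} {suc zero} _          i≢j _   = contradiction refl i≢j

module _ {n : ℕ} where

  private
    Hₙ : Graph
    Hₙ = H (2 ℕ.+ n)

  Universal : V Hₙ → Set
  Universal h = ∀ w → Covers Hₙ w h

  core-universal : ∀ i → Universal (inj₁ i)
  core-universal i (inj₂ k) = inj₂ (inj₂ (inj₂ tt))
  core-universal i (inj₁ j) with j Fin.≟ i
  ... | yes refl = inj₁ refl
  ... | no j≢i   = inj₂ (inj₁ (Pw.inj₁ j≢i))

  outer-independent : ∀ {k k′} → Covers Hₙ (inj₂ k) (inj₂ k′) → k ≡ k′
  outer-independent (inj₁ refl)                          = refl
  -- Adjacency in the complement of a complete graph pairs `k ≢ k′` with its own refutation.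
  outer-independent (inj₂ (inj₁ (Pw.inj₂ (k≢k′ , ¬adj)))) = contradiction k≢k′ ¬adj
  outer-independent (inj₂ (inj₂ (inj₁ ())))
  outer-independent (inj₂ (inj₂ (inj₂ ())))

  -- The vertex `punchIn i zero` is the other core vertex. A universal vertex outside the core would
  -- have to cover `inj₂ k`, hence equal it.
  third-universal-core : ∀ i k {h} → Universal h → h ≢ inj₁ i → h ≢ inj₂ k →
                         h ≡ inj₁ (punchIn i zero)
  third-universal-core i k {inj₁ l} _ h≢i _ =
    cong inj₁ (Fin2-third l (Fin.punchInᵢ≢i i zero ∘ sym) (h≢i ∘ cong inj₁))
  third-universal-core i k {inj₂ l} univ _ h≢k =
    contradiction (cong inj₂ (sym (outer-independent (univ (inj₂ k))))) h≢k

-- A vertex outside the core K₂ is universal only if n = 1.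
third-universal : ∀ {n} x y → Adj (H (2 ℕ.+ n)) x y →
                  ∃[ q ] (∀ {h} → Universal {n} h → h ≢ x → h ≢ y → h ≡ q)
third-universal (inj₁ i) (inj₂ k) _ =
  inj₁ (punchIn i zero) , λ univ h≢x h≢y → third-universal-core i k univ h≢x h≢y
third-universal (inj₂ k) (inj₁ i) _ =
  inj₁ (punchIn i zero) , λ univ h≢x h≢y → third-universal-core i k univ h≢y h≢x
third-universal (inj₂ k) (inj₂ l) (inj₁ (Pw.inj₂ (k≢l , ¬adj))) = contradiction k≢l ¬adj
third-universal (inj₂ k) (inj₂ l) (inj₂ (inj₁ ()))
third-universal (inj₂ k) (inj₂ l) (inj₂ (inj₂ ()))
third-universal {n} (inj₁ i) (inj₁ j) (inj₁ (Pw.inj₁ i≢j)) = outer n , λ {h} → sole n h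
  where
  outer : ∀ n → V (H (2 ℕ.+ n))
  -- A default value: for `n = 0` there is no vertex outside the core.
  outer zero    = inj₁ zero
  outer (suc _) = inj₂ zero

  sole : ∀ n h → Universal {n} h → h ≢ inj₁ i → h ≢ inj₁ j → h ≡ outer n
  sole n       (inj₁ l) _ h≢i h≢j =
    contradiction (cong inj₁ (Fin2-third l i≢j (h≢i ∘ cong inj₁))) h≢j
  -- Outer vertices are independent, so a universal one covers `inj₂ zero` only by being that
  -- vertex.
  sole (suc n) (inj₂ l) univ _ _  = cong inj₂ (sym (outer-independent (univ (inj₂ zero))))
third-universal (inj₁ i) (inj₁ j) (inj₂ (inj₁ ()))
third-universal (inj₁ i) (inj₁ j) (inj₂ (inj₂ ()))

-- Every F_{m₁,t,m₂} in the family has t ≥ 1 and m₂ ≥ 2, hence the shifted indices.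
F⁺ : (m₁ t n : ℕ) → Graph
F⁺ m₁ t n = F m₁ (suc t) (2 ℕ.+ n)

module Cover (m₁ t n : ℕ) where

  -- One constructor for each kind of closed adjacency: impossible covers are refuted by absurd
  -- patterns, and the edges of `F⁺` can be treated case by case.
  data Cover : V (F⁺ m₁ t n) → V (F⁺ m₁ t n) → Set where
    self : ∀ {x} → Cover x x
    h₁h₁ : ∀ {x y} → Adj (H m₁) x y → Cover (inH₁ x) (inH₁ y)
    h₂h₂ : ∀ {x y} → Adj (H (2 ℕ.+ n)) x y → Cover (inH₂ x) (inH₂ y)
    v₁h₁ : ∀ {x} → Cover v₁ (inH₁ x)
    h₁v₁ : ∀ {x} → Cover (inH₁ x) v₁
    v₂h₂ : ∀ {x} → Cover v₂ (inH₂ x)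
    h₂v₂ : ∀ {x} → Cover (inH₂ x) v₂
    v₁b  : ∀ {b} → Cover v₁ (inB b)
    bv₁  : ∀ {b} → Cover (inB b) v₁
    v₂b  : ∀ {b} → Cover v₂ (inB b)
    bv₂  : ∀ {b} → Cover (inB b) v₂

  new⇒cover : ∀ x y → T (F-new m₁ (suc t) (2 ℕ.+ n) x y) → Cover x y × Cover y x
  new⇒cover v₁       (inH₁ _) _ = v₁h₁ , h₁v₁
  new⇒cover v₁       (inB _)  _ = v₁b , bv₁
  new⇒cover v₂       (inH₂ _) _ = v₂h₂ , h₂v₂
  new⇒cover v₂       (inB _)  _ = v₂b , bv₂

  adj⇒cover : ∀ {x y} → Adj (F⁺ m₁ t n) x y → Cover x y
  adj⇒cover (inj₁ (Pw.inj₁ a)) = h₁h₁ a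
  adj⇒cover (inj₁ (Pw.inj₂ (Pw.inj₁ a))) = h₂h₂ a
  adj⇒cover (inj₁ (Pw.inj₂ (Pw.inj₂ (Pw.inj₁ (b≢c , ¬adj))))) = contradiction b≢c ¬adj
  adj⇒cover (inj₁ (Pw.inj₂ (Pw.inj₂ (Pw.inj₂ (b≢c , ¬adj))))) = contradiction b≢c ¬adj
  adj⇒cover {x} {y} (inj₂ (inj₁ new)) = proj₁ (new⇒cover x y new)
  adj⇒cover {x} {y} (inj₂ (inj₂ new)) = proj₂ (new⇒cover y x new)

  covers⇒cover : ∀ {x y} → Covers (F⁺ m₁ t n) x y → Cover x y
  covers⇒cover (inj₁ refl) = self
  covers⇒cover (inj₂ a)    = adj⇒cover a

  cover⇒covers : ∀ {x y} → Cover x y → Covers (F⁺ m₁ t n) x y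
  cover⇒covers self     = inj₁ refl
  cover⇒covers (h₁h₁ a) = inj₂ (inj₁ (Pw.inj₁ a))
  cover⇒covers (h₂h₂ a) = inj₂ (inj₁ (Pw.inj₂ (Pw.inj₁ a)))
  cover⇒covers v₁h₁     = inj₂ (inj₂ (inj₁ tt))
  cover⇒covers h₁v₁     = inj₂ (inj₂ (inj₂ tt))
  cover⇒covers v₂h₂     = inj₂ (inj₂ (inj₁ tt))
  cover⇒covers h₂v₂     = inj₂ (inj₂ (inj₂ tt))
  cover⇒covers v₁b      = inj₂ (inj₂ (inj₁ tt))
  cover⇒covers bv₁      = inj₂ (inj₂ (inj₂ tt))
  cover⇒covers v₂b      = inj₂ (inj₂ (inj₁ tt))
  cover⇒covers bv₂      = inj₂ (inj₂ (inj₂ tt))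

  deletion⇒cover : ∀ {u v x y} → Covers (F⁺ m₁ t n -[ u , v ]) x y → Cover x y
  deletion⇒cover = covers⇒cover ∘ Sum.map₂ proj₁

-- Exchanging the two sides of F

module Swap (n₁ t n₂ : ℕ) where

  swapSides : V (F⁺ (2 ℕ.+ n₁) t n₂) → V (F⁺ (2 ℕ.+ n₂) t n₁)
  swapSides (inH₁ h) = inH₂ h
  swapSides (inH₂ h) = inH₁ h
  swapSides (inB b)  = inB b
  swapSides v₁       = v₂
  swapSides v₂       = v₁

  open Cover (2 ℕ.+ n₁) t n₂

  swapSides-adj : ∀ {x y} → Adj (F⁺ (2 ℕ.+ n₁) t n₂) x y →
                  Adj (F⁺ (2 ℕ.+ n₂) t n₁) (swapSides x) (swapSides y)
  swapSides-adj {x} a with adj⇒cover a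
  ... | self   = contradiction a (Graph.loopless (F⁺ (2 ℕ.+ n₁) t n₂) x)
  ... | h₁h₁ b = inj₁ (Pw.inj₂ (Pw.inj₁ b))
  ... | h₂h₂ b = inj₁ (Pw.inj₁ b)
  ... | v₁h₁   = inj₂ (inj₁ tt)
  ... | h₁v₁   = inj₂ (inj₂ tt)
  ... | v₂h₂   = inj₂ (inj₁ tt)
  ... | h₂v₂   = inj₂ (inj₂ tt)
  ... | v₁b    = inj₂ (inj₁ tt)
  ... | bv₁    = inj₂ (inj₂ tt)
  ... | v₂b    = inj₂ (inj₁ tt)
  ... | bv₂    = inj₂ (inj₂ tt)

module _ (n₁ t n₂ : ℕ) where

  open Swap n₁ t n₂
  private module Back = Swap n₂ t n₁

  swapSides-inverse : ∀ x → Back.swapSides (swapSides x) ≡ x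
  swapSides-inverse (inH₁ h) = refl
  swapSides-inverse (inH₂ h) = refl
  swapSides-inverse (inB b)  = refl
  swapSides-inverse v₁       = refl
  swapSides-inverse v₂       = refl

swapSides-≅ : ∀ n₁ t n₂ → F⁺ (2 ℕ.+ n₁) t n₂ ≅ F⁺ (2 ℕ.+ n₂) t n₁
swapSides-≅ n₁ t n₂ = record
  { bijection = mk↔ₛ′ swapSides Back.swapSides
      (swapSides-inverse n₂ t n₁) (swapSides-inverse n₁ t n₂)
  ; adjacency = λ x y → mk⇔ (swapSides-adj {x} {y}) λ a →
      subst₂ (Adj (F⁺ (2 ℕ.+ n₁) t n₂))
        (swapSides-inverse n₁ t n₂ x) (swapSides-inverse n₁ t n₂ y)
        (Back.swapSides-adj a)
  }
  where
  open Swap n₁ t n₂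
  module Back = Swap n₂ t n₁

-- Dominating pairs and plans common to both cases

module Family (m₁ t n : ℕ) where

  open Cover m₁ t n

  core₂ : Fin 2 → V (F⁺ m₁ t n)
  core₂ i = inH₂ (inj₁ i)

  -- The closed neighbourhoods of `core₂ zero` and `v₁` are disjoint: the first lies in the `inH₂`
  -- part with `v₂`, the second in the `inH₁` and `inB` parts with `v₁`.
  noSingleton : NoSingleton (F⁺ m₁ t n)
  noSingleton x dom with dom (core₂ zero) | dom v₁
  ... | here c | here c′ with covers⇒cover c | covers⇒cover c′
  ... | self   | ()
  ... | h₂h₂ _ | ()
  ... | h₂v₂   | ()

  v₂-v₁-dominates : Dominates (F⁺ m₁ t n) (v₂ ∷ v₁ ∷ [])
  v₂-v₁-dominates (inH₁ _) = there (here (cover⇒covers h₁v₁))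
  v₂-v₁-dominates (inH₂ _) = here (cover⇒covers h₂v₂)
  v₂-v₁-dominates (inB _)  = here (cover⇒covers bv₂)
  v₂-v₁-dominates v₁       = there (here (cover⇒covers self))
  v₂-v₁-dominates v₂       = here (cover⇒covers self)

  core₂-v₁-dominates : ∀ i → Dominates (F⁺ m₁ t n) (core₂ i ∷ v₁ ∷ [])
  core₂-v₁-dominates i (inH₁ _) = there (here (cover⇒covers h₁v₁))
  core₂-v₁-dominates i (inH₂ h) =
    here (Sum.map (cong (λ z → inH₂ z)) (λ a → inj₁ (Pw.inj₂ (Pw.inj₁ a))) (core-universal {n} i h))
  core₂-v₁-dominates i (inB _)  = there (here (cover⇒covers bv₁))
  core₂-v₁-dominates i v₁       = there (here (cover⇒covers self))
  core₂-v₁-dominates i v₂       = here (cover⇒covers v₂h₂)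

  v₁-reply : ∀ {s} i → v₁ ≢ s → v₂ ≢ s → core₂ i ≢ s → Reply (F⁺ m₁ t n) s
  v₁-reply i v₁≢s v₂≢s core≢s = record
    { d≢s = v₁≢s ; c≢s = v₂≢s ; c≢d = λ () ; c′≢s = core≢s ; c′≢d = λ () ; c≢c′ = λ ()
    ; completes = v₂-v₁-dominates ; completes′ = core₂-v₁-dominates i }

  -- Dominator answers `v₁` by `v₂` and everything else by `v₁`. The completions `c` and `c′` of
  -- `v₂` are parameters because they lie in B if `m₁ = 0` and in the core of the first H otherwise.
  reply : ∀ {c c′} → c ≢ v₁ → c ≢ v₂ → c′ ≢ v₁ → c′ ≢ v₂ → c ≢ c′ →
          Dominates (F⁺ m₁ t n) (c ∷ v₂ ∷ []) → Dominates (F⁺ m₁ t n) (c′ ∷ v₂ ∷ []) →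
          ∀ s → Reply (F⁺ m₁ t n) s
  reply c≢v₁ c≢v₂ c′≢v₁ c′≢v₂ c≢c′ dom dom′ v₁ = record
    { d≢s = λ () ; c≢s = c≢v₁ ; c≢d = c≢v₂ ; c′≢s = c′≢v₁ ; c′≢d = c′≢v₂ ; c≢c′ = c≢c′
    ; completes = dom ; completes′ = dom′ }
  reply _ _ _ _ _ _ _ v₂ = record
    { d≢s = λ () ; c≢s = λ () ; c≢d = λ () ; c′≢s = λ () ; c′≢d = λ () ; c≢c′ = λ ()
    ; completes = core₂-v₁-dominates zero ; completes′ = core₂-v₁-dominates (suc zero) }
  reply _ _ _ _ _ _ _ (inH₁ _)              = v₁-reply zero (λ ()) (λ ()) (λ ())
  reply _ _ _ _ _ _ _ (inB _)               = v₁-reply zero (λ ()) (λ ()) (λ ())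
  reply _ _ _ _ _ _ _ (inH₂ (inj₁ zero))    = v₁-reply (suc zero) (λ ()) (λ ()) (λ ())
  reply _ _ _ _ _ _ _ (inH₂ (inj₁ (suc _))) = v₁-reply zero (λ ()) (λ ()) (λ ())
  reply _ _ _ _ _ _ _ (inH₂ (inj₂ _))       = v₁-reply zero (λ ()) (λ ()) (λ ())

  -- The witness `w` shows that a vertex of B and one of the second H never dominate together. It is
  -- another vertex of B if `m₁ = 0`, and a core vertex of the first H otherwise.
  module StallerTakesV₂
    (uncovered-pair : ∀ b h → ∃[ w ] (¬ Cover w (inB b) × ¬ Cover w (inH₂ h))) where

    -- A second vertex from either H would leave B uncovered, and one from B is excluded by
    -- `uncovered-pair`.
    partner-of-H₂ : ∀ {x h} → x ≢ v₂ → Dominates (F⁺ m₁ t n) (x ∷ inH₂ h ∷ []) → x ≡ v₁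
    partner-of-H₂ {inH₁ _} _ dom with dom (inB zero)
    ... | here c with () ← covers⇒cover c
    ... | there (here c) with () ← covers⇒cover c
    partner-of-H₂ {inH₂ _} _ dom with dom (inB zero)
    ... | here c with () ← covers⇒cover c
    ... | there (here c) with () ← covers⇒cover c
    partner-of-H₂ {inB b} {h} _ dom with uncovered-pair b h
    ... | w , ¬b , ¬h with dom w
    ... | here c         = contradiction (covers⇒cover c) ¬b
    ... | there (here c) = contradiction (covers⇒cover c) ¬h
    partner-of-H₂ {v₁} _ _ = refl
    partner-of-H₂ {v₂} x≢v₂ _ = contradiction refl x≢v₂

    -- With `v₂` gone, `core₂ zero` can be covered only from within its H, and the covering vertex
    -- needs `v₁` as partner. So `sole` has only to leave one candidate for that vertex.
    plan-core : ∀ {u v} q →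
      (∀ {h} → Dominates (F⁺ m₁ t n -[ u , v ]) (v₁ ∷ inH₂ h ∷ []) → h ≡ q) →
      StallerPlan (F⁺ m₁ t n -[ u , v ])
    plan-core {u} {v} q sole = plan-covering v₂ v₁ (inH₂ q) (core₂ zero) (λ ()) (λ ()) (λ ()) core
      where
      with-H₂ : ∀ {x h} → x ≢ v₂ → Dominates (F⁺ m₁ t n -[ u , v ]) (x ∷ inH₂ h ∷ []) →
                x ≡ v₁ × _≡_ {A = V (F⁺ m₁ t n)} (inH₂ h) (inH₂ q)
      with-H₂ x≢v₂ dom with refl ← partner-of-H₂ x≢v₂ (deletion-dominates (F⁺ m₁ t n) dom) =
        refl , cong (λ z → inH₂ z) (sole dom)

      core : ∀ {x y} → x ≢ v₂ → y ≢ v₂ → Dominates (F⁺ m₁ t n -[ u , v ]) (x ∷ y ∷ []) →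
             Covers (F⁺ m₁ t n -[ u , v ]) (core₂ zero) y → x ≡ v₁ × y ≡ inH₂ q
      core x≢v₂ y≢v₂ dom c with deletion⇒cover {u} {v} c
      ... | self   = with-H₂ x≢v₂ dom
      ... | h₂h₂ _ = with-H₂ x≢v₂ dom
      ... | h₂v₂   = contradiction refl y≢v₂

    plan-v₁h₁ : ∀ x → StallerPlan (F⁺ m₁ t n -[ v₁ , inH₁ x ])
    -- Here `inj₁ zero` is arbitrary: neither `v₁` nor the second H covers `inH₁ x` any more, so no
    -- candidate is left.
    plan-v₁h₁ x = plan-core (inj₁ zero) λ dom → case-v₁h₁ (dom (inH₁ x))
      where
      case-v₁h₁ : ∀ {A : Set} {h} →
        Any (Covers (F⁺ m₁ t n -[ v₁ , inH₁ x ]) (inH₁ x)) (v₁ ∷ inH₂ h ∷ []) → A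
      case-v₁h₁ (here c) = contradiction c (deletion-uncoversʳ (F⁺ m₁ t n) (inj₂ (inj₁ tt)))
      case-v₁h₁ (there (here c)) with () ← deletion⇒cover {v₁} {inH₁ x} c

    plan-v₁b : ∀ b → StallerPlan (F⁺ m₁ t n -[ v₁ , inB b ])
    plan-v₁b b = plan-core (inj₁ zero) λ dom → case-v₁b (dom (inB b))
      where
      case-v₁b : ∀ {A : Set} {h} →
        Any (Covers (F⁺ m₁ t n -[ v₁ , inB b ]) (inB b)) (v₁ ∷ inH₂ h ∷ []) → A
      case-v₁b (here c) = contradiction c (deletion-uncoversʳ (F⁺ m₁ t n) (inj₂ (inj₁ tt)))
      case-v₁b (there (here c)) with () ← deletion⇒cover {v₁} {inB b} c

    -- A partner of `v₁` has to cover the whole second H. The ends `x` and `y` no longer cover each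
    -- other, and `third-universal` leaves at most one other candidate.
    plan-h₂h₂ : ∀ x y → Adj (H (2 ℕ.+ n)) x y → StallerPlan (F⁺ m₁ t n -[ inH₂ x , inH₂ y ])
    plan-h₂h₂ x y xy = plan-core q λ {h} dom → sole
        (λ w → universal w (by-h dom w))
        (λ { refl → deletion-uncoversʳ (F⁺ m₁ t n) xyᴳ (by-h dom y) })
        (λ { refl → deletion-uncovers (F⁺ m₁ t n) xyᴳ (by-h dom x) })
      where
      q = proj₁ (third-universal {n} x y xy)
      sole = proj₂ (third-universal {n} x y xy)
      G′ = F⁺ m₁ t n -[ inH₂ x , inH₂ y ]
      xyᴳ : Adj (F⁺ m₁ t n) (inH₂ x) (inH₂ y)
      xyᴳ = inj₁ (Pw.inj₂ (Pw.inj₁ xy))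

      by-h : ∀ {h} → Dominates G′ (v₁ ∷ inH₂ h ∷ []) → ∀ w → Covers G′ (inH₂ w) (inH₂ h)
      by-h dom w with dom (inH₂ w)
      ... | here c with () ← deletion⇒cover {inH₂ x} {inH₂ y} c
      ... | there (here c) = c

      universal : ∀ {h} w → Covers G′ (inH₂ w) (inH₂ h) → Covers (H (2 ℕ.+ n)) w h
      universal w c with deletion⇒cover {inH₂ x} {inH₂ y} c
      ... | self   = inj₁ refl
      ... | h₂h₂ a = inj₂ a

-- The case of an empty first H

module NoH₁ (t n : ℕ) where

  open Cover 0 (suc t) n
  open Family 0 (suc t) n

  -- B has at least two vertices here, and the one different from `b` is adjacent to `v₁` and `v₂`
  -- only.
  another-leaf : ∀ b h → ∃[ w ] (¬ Cover w (inB b) × ¬ Cover w (inH₂ h))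
  another-leaf b h = inB (punchIn b zero) , independent (Fin.punchInᵢ≢i b zero) , λ ()
    where
    independent : ∀ {c} → c ≢ b → ¬ Cover (inB c) (inB b)
    independent c≢b self = c≢b refl

  open StallerTakesV₂ another-leaf

  -- With the first H empty, `v₂` covers everything except `v₁`, which any vertex of B covers.
  leaf-v₂-dominates : ∀ b → Dominates (F⁺ 0 (suc t) n) (inB b ∷ v₂ ∷ [])
  leaf-v₂-dominates b (inH₂ _) = there (here (cover⇒covers h₂v₂))
  leaf-v₂-dominates b (inB _)  = there (here (cover⇒covers bv₂))
  leaf-v₂-dominates b v₁       = here (cover⇒covers v₁b)
  leaf-v₂-dominates b v₂       = there (here (cover⇒covers self))

  -- Two vertices of B leave `core₂ zero` uncovered; a vertex of the second H leaves another vertex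
  -- of B uncovered.
  partner-of-leaf : ∀ {x b} → x ≢ v₁ → Dominates (F⁺ 0 (suc t) n) (x ∷ inB b ∷ []) → x ≡ v₂
  partner-of-leaf {v₁} x≢v₁ _ = contradiction refl x≢v₁
  partner-of-leaf {v₂} _ _ = refl
  partner-of-leaf {inB _} _ dom with dom (core₂ zero)
  ... | here c with () ← covers⇒cover c
  ... | there (here c) with () ← covers⇒cover c
  partner-of-leaf {inH₂ h} {b} _ dom with another-leaf b h
  ... | w , ¬b , ¬h with dom w
  ... | here c         = contradiction (covers⇒cover c) ¬h
  ... | there (here c) = contradiction (covers⇒cover c) ¬b

  -- Staller takes `v₁`, which is then itself the vertex to be covered: only B can do that, and the
  -- partner must be `v₂`.
  plan-leaf : ∀ {u v} q →
    (∀ {b} → Dominates (F⁺ 0 (suc t) n -[ u , v ]) (v₂ ∷ inB b ∷ []) → b ≡ q) →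
    StallerPlan (F⁺ 0 (suc t) n -[ u , v ])
  plan-leaf {u} {v} q sole = plan-covering v₁ v₂ (inB q) v₁ (λ ()) (λ ()) (λ ()) core
    where
    core : ∀ {x y} → x ≢ v₁ → y ≢ v₁ → Dominates (F⁺ 0 (suc t) n -[ u , v ]) (x ∷ y ∷ []) →
           Covers (F⁺ 0 (suc t) n -[ u , v ]) v₁ y → x ≡ v₂ × y ≡ inB q
    core x≢v₁ y≢v₁ dom c with deletion⇒cover {u} {v} c
    ... | self = contradiction refl y≢v₁
    ... | v₁b with refl ← partner-of-leaf x≢v₁ (deletion-dominates (F⁺ 0 (suc t) n) dom) =
      refl , cong (λ z → inB z) (sole dom)

  plan-v₂h₂ : ∀ x → StallerPlan (F⁺ 0 (suc t) n -[ v₂ , inH₂ x ])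
  -- An arbitrary index: nothing in B covers `inH₂ x`, so no pair with `v₂` is left.
  plan-v₂h₂ x = plan-leaf zero λ dom → case-v₂h₂ (dom (inH₂ x))
    where
    case-v₂h₂ : ∀ {A : Set} {b} →
      Any (Covers (F⁺ 0 (suc t) n -[ v₂ , inH₂ x ]) (inH₂ x)) (v₂ ∷ inB b ∷ []) → A
    case-v₂h₂ (here c) = contradiction c (deletion-uncoversʳ (F⁺ 0 (suc t) n) (inj₂ (inj₁ tt)))
    case-v₂h₂ (there (here c)) with () ← deletion⇒cover {v₂} {inH₂ x} c

  plan-v₂b : ∀ b → StallerPlan (F⁺ 0 (suc t) n -[ v₂ , inB b ])
  -- Cut off from `v₂`, the vertex `inB b` must be covered by the partner of `v₂` from B, which is
  -- therefore `inB b` itself.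
  plan-v₂b b = plan-leaf b λ dom → case-v₂b (dom (inB b))
    where
    case-v₂b : ∀ {c} →
      Any (Covers (F⁺ 0 (suc t) n -[ v₂ , inB b ]) (inB b)) (v₂ ∷ inB c ∷ []) → c ≡ b
    case-v₂b (here c) = contradiction c (deletion-uncoversʳ (F⁺ 0 (suc t) n) (inj₂ (inj₁ tt)))
    case-v₂b (there (here c)) with self ← deletion⇒cover {v₂} {inB b} c = refl

  critical : Critical (F⁺ 0 (suc t) n)
  critical = record
    { vertex = v₁
    ; reply = reply {inB zero} {inB (suc zero)} (λ ()) (λ ()) (λ ()) (λ ()) (λ ())
        (leaf-v₂-dominates zero) (leaf-v₂-dominates (suc zero))
    ; noSingleton = noSingleton
    ; plan = λ _ _ uv → plans (adj⇒cover uv) uv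
    }
    where
    plans : ∀ {u v} → Cover u v → Adj (F⁺ 0 (suc t) n) u v →
            StallerPlan (F⁺ 0 (suc t) n -[ u , v ])
    plans (self {x})     uv = contradiction uv (Graph.loopless (F⁺ 0 (suc t) n) x)
    plans (h₂h₂ {x} {y} a) _ = plan-h₂h₂ x y a
    plans (v₂h₂ {x})     _  = plan-v₂h₂ x
    plans (h₂v₂ {x})     _  = plan-flip (F⁺ 0 (suc t) n) v₂ (inH₂ x) (plan-v₂h₂ x)
    plans (v₁b {b})      _  = plan-v₁b b
    plans (bv₁ {b})      _  = plan-flip (F⁺ 0 (suc t) n) v₁ (inB b) (plan-v₁b b)
    plans (v₂b {b})      _  = plan-v₂b b
    plans (bv₂ {b})      _  = plan-flip (F⁺ 0 (suc t) n) v₂ (inB b) (plan-v₂b b)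

-- A core vertex of the first H has all its neighbours in that H and at `v₁`.
core-uncovered : ∀ n₁ t n₂ → let open Cover (2 ℕ.+ n₁) t n₂ in
                 ∀ b h → ∃[ w ] (¬ Cover w (inB b) × ¬ Cover w (inH₂ h))
core-uncovered n₁ t n₂ b h = inH₁ (inj₁ zero) , (λ ()) , (λ ())

-- The case of a nonempty first H

module WithH₁ (n₁ t n₂ : ℕ) where

  open Cover (2 ℕ.+ n₁) t n₂
  open Swap n₁ t n₂ using (swapSides)
  open Family (2 ℕ.+ n₁) t n₂
  open StallerTakesV₂ (core-uncovered n₁ t n₂)

  private
    module Swapped where
      module Side = Family (2 ℕ.+ n₂) t n₁
      open Side using (core₂-v₁-dominates) public
      open Side.StallerTakesV₂ (core-uncovered n₂ t n₁) public

    -- Deletions at `v₂` or inside the first H become deletions at `v₁` or inside the second H of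
    -- the mirror graph, where Staller's plan of taking `v₂` applies.
    unswap : ∀ u v →
             StallerPlan (F⁺ (2 ℕ.+ n₂) t n₁ -[ swapSides u , swapSides v ]) →
             StallerPlan (F⁺ (2 ℕ.+ n₁) t n₂ -[ u , v ])
    unswap u v = plan-≅ (deletion-≅ (swapSides-≅ n₁ t n₂) u v)

  core₁-v₂-dominates : ∀ i → Dominates (F⁺ (2 ℕ.+ n₁) t n₂) (inH₁ (inj₁ i) ∷ v₂ ∷ [])
  core₁-v₂-dominates i = dominates-from (swapSides-≅ n₁ t n₂) (Swapped.core₂-v₁-dominates i)

  critical : Critical (F⁺ (2 ℕ.+ n₁) t n₂)
  critical = record
    { vertex = v₁
    ; reply = reply {inH₁ (inj₁ zero)} {inH₁ (inj₁ (suc zero))}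
        (λ ()) (λ ()) (λ ()) (λ ()) (λ ())
        (core₁-v₂-dominates zero) (core₁-v₂-dominates (suc zero))
    ; noSingleton = noSingleton
    ; plan = λ _ _ uv → plans (adj⇒cover uv) uv
    }
    where
    plan-v₂h₂ : ∀ x → StallerPlan (F⁺ (2 ℕ.+ n₁) t n₂ -[ v₂ , inH₂ x ])
    plan-v₂h₂ x = unswap v₂ (inH₂ x) (Swapped.plan-v₁h₁ x)

    plan-v₂b : ∀ b → StallerPlan (F⁺ (2 ℕ.+ n₁) t n₂ -[ v₂ , inB b ])
    plan-v₂b b = unswap v₂ (inB b) (Swapped.plan-v₁b b)

    plans : ∀ {u v} → Cover u v → Adj (F⁺ (2 ℕ.+ n₁) t n₂) u v →
            StallerPlan (F⁺ (2 ℕ.+ n₁) t n₂ -[ u , v ])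
    plans (self {x})     uv = contradiction uv (Graph.loopless (F⁺ (2 ℕ.+ n₁) t n₂) x)
    plans (h₁h₁ {x} {y} a) _ = unswap (inH₁ x) (inH₁ y) (Swapped.plan-h₂h₂ x y a)
    plans (h₂h₂ {x} {y} a) _ = plan-h₂h₂ x y a
    plans (v₁h₁ {x})     _  = plan-v₁h₁ x
    plans (h₁v₁ {x})     _  = plan-flip (F⁺ (2 ℕ.+ n₁) t n₂) v₁ (inH₁ x) (plan-v₁h₁ x)
    plans (v₂h₂ {x})     _  = plan-v₂h₂ x
    plans (h₂v₂ {x})     _  = plan-flip (F⁺ (2 ℕ.+ n₁) t n₂) v₂ (inH₂ x) (plan-v₂h₂ x)
    plans (v₁b {b})      _  = plan-v₁b b
    plans (bv₁ {b})      _  = plan-flip (F⁺ (2 ℕ.+ n₁) t n₂) v₁ (inB b) (plan-v₁b b)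
    plans (v₂b {b})      _  = plan-v₂b b
    plans (bv₂ {b})      _  = plan-flip (F⁺ (2 ℕ.+ n₁) t n₂) v₂ (inB b) (plan-v₂b b)

-- All members of the family

F-critical : ∀ m₁ t m₂ → 1 ℕ.≤ t → m₁ ≡ 0 ⊎ 2 ℕ.≤ m₁ → 2 ℕ.≤ m₂ → (m₁ ≡ 0 → 2 ℕ.≤ t) →
             Critical (F m₁ t m₂)
-- Matching on the bounds exposes the successors that turn `F` into `F⁺`; for `m₁ = 0` a second one
-- comes off `t`, giving the extra vertex of B.
F-critical .0 t m₂ _ (inj₁ refl) (s≤s (s≤s _)) t≥2 with s≤s (s≤s _) ← t≥2 refl =
  NoH₁.critical _ _
F-critical m₁ t m₂ (s≤s _) (inj₂ (s≤s (s≤s _))) (s≤s (s≤s _)) _ = WithH₁.critical _ _ _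

proposition4p1 : (G : Graph) → G ∈ 𝓕 → 2 -γ′MB-critical G
proposition4p1 G G∈𝓕 = critical⇒2-critical
  (critical-≅ isomorphic (F-critical m₁ t m₂ t≥1 m₁-range m₂≥2 m₁≡0⇒t≥2))
  where open 𝓕 G∈𝓕
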